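{- There are infinitely many permutations $\pi$ such that the principal class $\operatorname{Av}(\pi)$ is deflatable.
   Context: A permutation $\alpha$ is contained in $\beta$ if $\beta$ has a subsequence in the same relative order as $\alpha$; a class is a set of permutations closed under taking contained permutations; $\operatorname{Av}(\pi)$ is the (principal) class of permutations not containing $\pi$. An interval of a permutation is a set of entries whose positions and values each form a set of consecutive integers, the whole permutation not counting as an interval; a permutation is simple if all its intervals are single entries (so $1$, $12$, $21$ are simple). A class $\mathcal{C}$ is deflatable if there is a proper subclass $\mathcal{D}\subsetneq\mathcal{C}$ with $\mathcal{C}\subseteq\langle\mathcal{D}\rangle$, where the substitution closure $\langle\mathcal{D}\rangle$ is the largest class whose simple permutations are exactly those of $\mathcal{D}$; equivalently, $\mathcal{C}$ is deflatable if and only if some permutation in $\mathcal{C}$ is not contained in any simple permutation belonging to $\mathcal{C}$. -}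

module Defs where

open import Data.Nat using (ℕ; zero; suc; _+_; _∸_; _≤_; _<_)
open import Data.Fin using (Fin; toℕ)
open import Data.Fin.Base using () renaming (_<_ to _<ᶠ_)
open import Data.Product using (Σ; ∃; _×_; _,_)
open import Relation.Binary.PropositionalEquality using (_≡_)
open import Relation.Nullary using (¬_)
open import Function.Definitions using (Injective)

-- A permutation of length len: an injective (hence bijective) map
-- Fin len → Fin len; entry at position i (0-based) has value f i.
record Perm : Set where
  constructor perm
  field
    len : ℕ
    f   : Fin len → Fin len
    inj : Injective _≡_ _≡_ f
open Perm public

_≼_ : Perm → Perm → Set
α ≼ β = Σ (Fin (len α) → Fin (len β)) λ e →
          (∀ i j → i <ᶠ j → e i <ᶠ e j)
        × (∀ i j → (f α i <ᶠ f α j → f β (e i) <ᶠ f β (e j))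
                 × (f β (e i) <ᶠ f β (e j) → f α i <ᶠ f α j))

IsClass : (Perm → Set) → Set
IsClass C = ∀ α β → α ≼ β → C β → C α

Av : Perm → Perm → Set
Av π σ = ¬ (π ≼ σ)

-- Interval of p occupying positions a..b (inclusive, 0-based): the positions
-- are consecutive and the values lie in a window of b - a + 1 consecutive
-- integers (so, by injectivity, form a set of consecutive integers); the
-- whole permutation (a = 0, b = len - 1) does not count.
IsInterval : (p : Perm) → ℕ → ℕ → Set
IsInterval p a b =
    a ≤ b × b < len p × ¬ (a ≡ 0 × suc b ≡ len p)
  × ∃ λ c → ∀ (i : Fin (len p)) → a ≤ toℕ i → toℕ i ≤ b →
              c ≤ toℕ (f p i) × toℕ (f p i) ≤ c + (b ∸ a)

Simple : Perm → Set
Simple p = ∀ a b → IsInterval p a b → a ≡ b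

-- Substitution closure ⟨D⟩: the largest class whose simple permutations
-- are exactly those of D, i.e. the permutations all of whose simple
-- subpermutations lie in D.
SubstClosure : (Perm → Set) → Perm → Set
SubstClosure D σ = ∀ τ → Simple τ → τ ≼ σ → D τ

Deflatable : (Perm → Set) → Set₁
Deflatable C = Σ (Perm → Set) λ D →
    IsClass D
  × (∀ σ → D σ → C σ)
  × (∃ λ σ → C σ × ¬ D σ)
  × (∀ σ → C σ → SubstClosure D σ)

-- Let π = 25314[213, 132, δ, 213, 132] with δ decreasing, as long as we please. The entries
-- 2, 5, 1, 4 of 25314 are its leftmost, topmost, lowest and rightmost ones. Let σ consist of an
-- interval I = 12 and four overlaid copies of π, each lacking another one of the blocks of
-- size three, in whose place it uses I. In a simple permutation containing σ some entry x cuts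
-- the rectangular hull of I; from above or from the right it turns I into 132, from below or from
-- the left into 213. In the copy where I stands for the topmost block all other entries lie
-- below I, so an x above I restores π, and likewise in the other three directions: every simple
-- permutation containing σ contains π. The copies can be interleaved so that σ itself avoids
-- π: if δ is long, one of its entries is sent into one of the four decreasing
-- sequences of σ, and from there a short finite search excludes all continuations.
module Submission where

open import Defs
open import Data.Nat using (ℕ; _≤_)
open import Data.Product using (Σ; _×_)

open import Data.Bool using (Bool; true; false; _∨_; if_then_else_; T)
open import Data.Bool.ListAction using (all)
open import Data.Empty using (⊥; ⊥-elim)
open import Data.Fin using (Fin; zero; suc; toℕ; fromℕ<; punchOut; splitAt; join; combine;
  remQuot; _↑ˡ_; _↑ʳ_; opposite; #_)
  renaming (_<_ to _<ᶠ_)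
import Data.Fin.Properties as Fin
open import Data.List using (List; filter; null; allFin)
import Data.List as List
open import Data.List.Membership.Propositional using (_∈_)
open import Data.List.Membership.Propositional.Properties using (∈-filter⁺; ∈-allFin; ∈-map⁺)
import Data.List.Relation.Unary.All as All
open import Data.List.Relation.Unary.All.Properties using (all⁺)
open import Data.Maybe using (Maybe; just; nothing)
open import Data.Nat using (zero; suc; _<ᵇ_; _+_; _*_; _∸_; _<_; z≤n; s≤s; s≤s⁻¹)
import Data.Nat.Properties as ℕ
open import Data.Product using (∃; _,_; proj₁; proj₂)
open import Data.Sum using (_⊎_; inj₁; inj₂; [_,_]′)
open import Data.Unit using (⊤; tt)
import Data.Vec as Vec
open import Data.Vec using (Vec; []; _∷_; lookup)
open import Function using (_∘_; id)
open import Function.Definitions using (Injective)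
open import Relation.Binary.Definitions using (tri<; tri≈; tri>)
open import Relation.Binary.PropositionalEquality
open import Relation.Nullary using (¬_; Dec; yes; no; contradiction)
open import Relation.Nullary.Decidable using (_×-dec_; _→-dec_; _⊎-dec_; toWitness; True)

-- The containment order and a criterion for deflatability.

≼-refl : ∀ α → α ≼ α
≼-refl α = id , (λ _ _ i<j → i<j) , λ _ _ → id , id

≼-trans : ∀ {α β γ} → α ≼ β → β ≼ γ → α ≼ γ
≼-trans (e , e-pos , e-val) (g , g-pos , g-val) =
  g ∘ e , (λ i j → g-pos _ _ ∘ e-pos i j) ,
  λ i j → proj₁ (g-val _ _) ∘ proj₁ (e-val i j) , proj₂ (e-val i j) ∘ proj₂ (g-val _ _)

-- The proper subclass consists of the permutations avoiding both `π` and `σ`. It misses `σ`, and a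
-- simple `τ` inside some `ρ` that avoids `π` cannot contain `σ`, for then `ρ` would contain `π`
-- through `τ`.
deflatable-Av : ∀ π σ → ¬ (π ≼ σ) → (∀ τ → Simple τ → σ ≼ τ → π ≼ τ) → Deflatable (Av π)
deflatable-Av π σ π⋠σ forced =
  (λ ρ → ¬ (π ≼ ρ) × ¬ (σ ≼ ρ)) ,
  (λ α β α≼β (a , b) → (λ p → a (≼-trans {π} {α} {β} p α≼β)) , (λ s → b (≼-trans {σ} {α} {β} s α≼β))) ,
  (λ _ → proj₁) ,
  (σ , π⋠σ , λ (_ , b) → b (≼-refl σ)) ,
  λ ρ π⋠ρ τ simple τ≼ρ →
    (λ p → π⋠ρ (≼-trans {π} {τ} {ρ} p τ≼ρ)) ,
    (λ s → π⋠ρ (≼-trans {π} {τ} {ρ} (forced τ simple s) τ≼ρ))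

-- Cuts of an increasing pair in a simple permutation.

-- Punching out a missed value `y` would leave an injection into a set with one element fewer.
injective⇒surjective : ∀ {n} (g : Fin n → Fin n) → Injective _≡_ _≡_ g → ∀ y → ∃ λ x → g x ≡ y
injective⇒surjective {suc n} g g-inj y with Fin.any? (λ x → g x Fin.≟ y)
... | yes hit = hit
... | no miss = contradiction (Fin.injective⇒≤ squeeze-inj) ℕ.1+n≰n
  where
  squeeze : Fin (suc n) → Fin n
  squeeze x = punchOut {i = y} (λ eq → miss (x , sym eq))
  squeeze-inj : Injective _≡_ _≡_ squeeze
  squeeze-inj {x} {x′} = g-inj ∘ Fin.punchOut-injective (λ eq → miss (x , sym eq)) (λ eq → miss (x′ , sym eq))

-- For `p` to the left of and below `q`, these are the entries in exactly one of the two strips,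
-- vertical and horizontal, between them: what keeps their rectangular hull from being an interval.
data Cut (τ : Perm) (p q : Fin (len τ)) : Set where
  above   : ∀ x → p <ᶠ x → x <ᶠ q → f τ q <ᶠ f τ x → Cut τ p q
  below   : ∀ x → p <ᶠ x → x <ᶠ q → f τ x <ᶠ f τ p → Cut τ p q
  leftOf  : ∀ x → f τ p <ᶠ f τ x → f τ x <ᶠ f τ q → x <ᶠ p → Cut τ p q
  rightOf : ∀ x → f τ p <ᶠ f τ x → f τ x <ᶠ f τ q → q <ᶠ x → Cut τ p q

module _ (τ : Perm) {p q : Fin (len τ)} (p<q : p <ᶠ q) (fp<fq : f τ p <ᶠ f τ q) where

  private
    val : Fin (len τ) → ℕ
    val i = toℕ (f τ i)

    val-injective : ∀ {i j} → val i ≡ val j → i ≡ j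
    val-injective = inj τ ∘ Fin.toℕ-injective

    strict : ∀ {i j} → ¬ i ≡ j → val i ≤ val j → val i < val j
    strict i≢j le = ℕ.≤∧≢⇒< le (i≢j ∘ val-injective)

  -- The first hypothesis keeps the values at positions from `p` to `q` between those of `p` and
  -- `q`. By the second, every value in that range is taken at one of these positions, so the hull
  -- is no taller than wide and the values fit the window that `IsInterval` demands.
  uncut⇒interval :
    (∀ x → p <ᶠ x → x <ᶠ q → val p ≤ val x × val x ≤ val q) →
    (∀ x → val p < val x → val x < val q → toℕ p ≤ toℕ x × toℕ x ≤ toℕ q) →
    ∀ i → toℕ p ≤ toℕ i → toℕ i ≤ toℕ q →
    val p ≤ val i × val i ≤ val p + (toℕ q ∸ toℕ p)
  uncut⇒interval noVertical noHorizontal i p≤i i≤q =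
    proj₁ within , ℕ.≤-trans (proj₂ within) height≤width
    where
    within : val p ≤ val i × val i ≤ val q
    within with p Fin.≟ i | i Fin.≟ q
    ... | yes refl | _ = ℕ.≤-refl , ℕ.<⇒≤ fp<fq
    ... | no _ | yes refl = ℕ.<⇒≤ fp<fq , ℕ.≤-refl
    ... | no p≢i | no i≢q =
      noVertical i (ℕ.≤∧≢⇒< p≤i (p≢i ∘ Fin.toℕ-injective)) (ℕ.≤∧≢⇒< i≤q (i≢q ∘ Fin.toℕ-injective))

    position : ∀ v → val p ≤ v → v ≤ val q → ∃ λ z → val z ≡ v × toℕ p ≤ toℕ z × toℕ z ≤ toℕ q
    position v p≤v v≤q with injective⇒surjective (f τ) (inj τ) (fromℕ< (ℕ.≤-<-trans v≤q (Fin.toℕ<n (f τ q))))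
    ... | z , eq = z , val-z , inside
      where
      val-z : val z ≡ v
      val-z = trans (cong toℕ eq) (Fin.toℕ-fromℕ< _)
      inside : toℕ p ≤ toℕ z × toℕ z ≤ toℕ q
      inside with p Fin.≟ z | z Fin.≟ q
      ... | yes refl | _ = ℕ.≤-refl , ℕ.<⇒≤ p<q
      ... | no _ | yes refl = ℕ.<⇒≤ p<q , ℕ.≤-refl
      ... | no p≢z | no z≢q =
        noHorizontal z (strict p≢z (subst (val p ≤_) (sym val-z) p≤v)) (strict z≢q (subst (_≤ val q) (sym val-z) v≤q))

    posAt : (u : Fin (suc (val q ∸ val p))) → ∃ λ z → val z ≡ val p + toℕ u × toℕ p ≤ toℕ z × toℕ z ≤ toℕ q
    posAt u = position (val p + toℕ u) (ℕ.m≤m+n _ _)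
      (ℕ.≤-trans (ℕ.+-monoʳ-≤ (val p) (s≤s⁻¹ (Fin.toℕ<n u))) (ℕ.≤-reflexive (ℕ.m+[n∸m]≡n (ℕ.<⇒≤ fp<fq))))

    g : Fin (suc (val q ∸ val p)) → Fin (suc (toℕ q ∸ toℕ p))
    g u = let z , _ , _ , z≤q = posAt u in fromℕ< (s≤s (ℕ.∸-monoˡ-≤ (toℕ p) z≤q))

    g-injective : Injective _≡_ _≡_ g
    g-injective {u} {w} eq = Fin.toℕ-injective (ℕ.+-cancelˡ-≡ (val p) _ _
      (trans (sym (proj₁ (proj₂ (posAt u)))) (trans (cong val same) (proj₁ (proj₂ (posAt w))))))
      where
      same : proj₁ (posAt u) ≡ proj₁ (posAt w)
      same = Fin.toℕ-injective (ℕ.∸-cancelʳ-≡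
        (proj₁ (proj₂ (proj₂ (posAt u)))) (proj₁ (proj₂ (proj₂ (posAt w))))
        (Fin.fromℕ<-injective _ _ _ _ eq))

    height≤width : val q ≤ val p + (toℕ q ∸ toℕ p)
    height≤width = ℕ.≤-trans (ℕ.≤-reflexive (sym (ℕ.m+[n∸m]≡n (ℕ.<⇒≤ fp<fq))))
      (ℕ.+-monoʳ-≤ (val p) (s≤s⁻¹ (Fin.injective⇒≤ g-injective)))

  -- If the four searches for a cut all fail, the positions from `p` to `q` form an interval with at
  -- least two entries.
  simple⇒cut : Simple τ → (∃ λ r → q <ᶠ r) → Cut τ p q
  simple⇒cut simple (r , q<r)
    with Fin.any? (λ x → p Fin.<? x ×-dec x Fin.<? q ×-dec f τ q Fin.<? f τ x)
       | Fin.any? (λ x → p Fin.<? x ×-dec x Fin.<? q ×-dec f τ x Fin.<? f τ p)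
       | Fin.any? (λ x → f τ p Fin.<? f τ x ×-dec f τ x Fin.<? f τ q ×-dec x Fin.<? p)
       | Fin.any? (λ x → f τ p Fin.<? f τ x ×-dec f τ x Fin.<? f τ q ×-dec q Fin.<? x)
  ... | yes (x , a , b , c) | _ | _ | _ = above x a b c
  ... | _ | yes (x , a , b , c) | _ | _ = below x a b c
  ... | _ | _ | yes (x , a , b , c) | _ = leftOf x a b c
  ... | _ | _ | _ | yes (x , a , b , c) = rightOf x a b c
  ... | no ¬a | no ¬b | no ¬l | no ¬r = contradiction (simple (toℕ p) (toℕ q) interval) (ℕ.<⇒≢ p<q)
    where
    interval : IsInterval τ (toℕ p) (toℕ q)
    interval = ℕ.<⇒≤ p<q , Fin.toℕ<n q ,
      -- The entry `r` beyond `q` keeps the interval from being the whole permutation.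
      (λ (_ , eq) → ℕ.<⇒≱ (Fin.toℕ<n r) (subst (_≤ toℕ r) eq q<r)) ,
      val p , uncut⇒interval
        (λ x a b → ℕ.≮⇒≥ (λ c → ¬b (x , a , b , c)) , ℕ.≮⇒≥ (λ c → ¬a (x , a , b , c)))
        (λ x a b → ℕ.≮⇒≥ (λ c → ¬l (x , a , b , c)) , ℕ.≮⇒≥ (λ c → ¬r (x , a , b , c)))

-- Ranks and the standardisation of a planar point set.

count< : ∀ {n} → (Fin n → ℕ) → ℕ → ℕ
count< {zero}  X v = 0
count< {suc n} X v = (if X zero <ᵇ v then 1 else 0) + count< (X ∘ suc) v

indicator-mono : ∀ u {v w} → v ≤ w → (if u <ᵇ v then 1 else 0) ≤ (if u <ᵇ w then 1 else 0)
indicator-mono u {v} {w} v≤w with u <ᵇ v in u<v | u <ᵇ w in u<w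
... | false | _     = z≤n
... | true  | true  = ℕ.≤-refl
... | true  | false = ⊥-elim (subst T u<w (ℕ.<⇒<ᵇ (ℕ.<-≤-trans (ℕ.<ᵇ⇒< u v (subst T (sym u<v) tt)) v≤w)))

count<-mono : ∀ {n} (X : Fin n → ℕ) {v w} → v ≤ w → count< X v ≤ count< X w
count<-mono {zero}  X v≤w = z≤n
count<-mono {suc n} X v≤w = ℕ.+-mono-≤ (indicator-mono (X zero) v≤w) (count<-mono (X ∘ suc) v≤w)

count<-≤ : ∀ {n} (X : Fin n → ℕ) v → count< X v ≤ n
count<-≤ {zero}  X v = z≤n
count<-≤ {suc n} X v with X zero <ᵇ v
... | true  = s≤s (count<-≤ (X ∘ suc) v)
... | false = ℕ.m≤n⇒m≤1+n (count<-≤ (X ∘ suc) v)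

-- The index `i` itself is counted at `w` but not at `X i`.
count<-strict : ∀ {n} (X : Fin n → ℕ) i {w} → X i < w → count< X (X i) < count< X w
count<-strict X zero {w} lt with X zero <ᵇ X zero in irr | X zero <ᵇ w in X<w
... | true  | _     = ⊥-elim (ℕ.<-irrefl refl (ℕ.<ᵇ⇒< (X zero) (X zero) (subst T (sym irr) tt)))
... | false | false = ⊥-elim (subst T X<w (ℕ.<⇒<ᵇ lt))
... | false | true  = s≤s (count<-mono (X ∘ suc) (ℕ.<⇒≤ lt))
count<-strict X (suc i) lt = ℕ.+-mono-≤-< (indicator-mono (X zero) (ℕ.<⇒≤ lt)) (count<-strict (X ∘ suc) i lt)

module Rank {n} (X : Fin n → ℕ) (X-inj : Injective _≡_ _≡_ X) where

  rank : Fin n → Fin n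
  -- Passing to `suc (X i)` counts `i` as well, so the count at `X i` stays below `n`.
  rank i = fromℕ< (ℕ.<-≤-trans (count<-strict X i (ℕ.n<1+n (X i))) (count<-≤ X (suc (X i))))

  rank-mono : ∀ {i j} → X i < X j → rank i <ᶠ rank j
  rank-mono {i} {j} lt = subst₂ _<_ (sym (Fin.toℕ-fromℕ< _)) (sym (Fin.toℕ-fromℕ< _)) (count<-strict X i lt)

  rank-cancel : ∀ {i j} → rank i <ᶠ rank j → X i < X j
  rank-cancel {i} {j} lt with ℕ.<-cmp (X i) (X j)
  ... | tri< Xi<Xj _ _ = Xi<Xj
  ... | tri≈ _ eq _    = contradiction lt (ℕ.<-irrefl (cong (toℕ ∘ rank) (X-inj eq)))
  ... | tri> _ _ Xj<Xi = contradiction (rank-mono Xj<Xi) (ℕ.<-asym lt)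

  rank-injective : Injective _≡_ _≡_ rank
  rank-injective {i} {j} eq with ℕ.<-cmp (X i) (X j)
  ... | tri< Xi<Xj _ _ = contradiction (rank-mono Xi<Xj) (ℕ.<-irrefl (cong toℕ eq))
  ... | tri≈ _ Xi≡Xj _ = X-inj Xi≡Xj
  ... | tri> _ _ Xj<Xi = contradiction (rank-mono Xj<Xi) (ℕ.<-irrefl (cong toℕ (sym eq)))

  unrank : Fin n → Fin n
  unrank p = proj₁ (injective⇒surjective rank rank-injective p)

  rank-unrank : ∀ p → rank (unrank p) ≡ p
  rank-unrank p = proj₂ (injective⇒surjective rank rank-injective p)

  unrank-mono : ∀ {p q} → p <ᶠ q → X (unrank p) < X (unrank q)
  unrank-mono {p} {q} p<q = rank-cancel (subst₂ _<ᶠ_ (sym (rank-unrank p)) (sym (rank-unrank q)) p<q)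

module PointSet {n} (X Y : Fin n → ℕ) (X-inj : Injective _≡_ _≡_ X) (Y-inj : Injective _≡_ _≡_ Y) where

  private
    module RX = Rank X X-inj
    module RY = Rank Y Y-inj

  -- The permutation order isomorphic to the points `(X i , Y i)`, read from left to right.
  standardise : Perm
  standardise = perm n (RY.rank ∘ RX.unrank)
    (λ {p} {q} eq → trans (sym (RX.rank-unrank p)) (trans (cong RX.rank (RY.rank-injective eq)) (RX.rank-unrank q)))

  position : Fin n → Fin n
  position = RX.rank

  point : Fin n → Fin n
  point = RX.unrank

  position-mono : ∀ {i j} → X i < X j → position i <ᶠ position j
  position-mono = RX.rank-mono

  point-position : ∀ i → point (position i) ≡ i
  point-position i = RX.rank-injective (RX.rank-unrank (position i))

  value-mono : ∀ {i j} → Y i < Y j → f standardise (position i) <ᶠ f standardise (position j)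
  value-mono {i} {j} lt = RY.rank-mono (subst₂ _<_ (cong Y (sym (point-position i))) (cong Y (sym (point-position j))) lt)

  point-mono : ∀ {p q} → p <ᶠ q → X (point p) < X (point q)
  point-mono = RX.unrank-mono

  point-value-mono : ∀ {p q} → f standardise p <ᶠ f standardise q → Y (point p) < Y (point q)
  point-value-mono = RY.rank-cancel

  -- Preserving both orders suffices: distinct points have distinct `Y`, so by trichotomy the order
  -- of values is reflected too.
  embed : ∀ {τ} (g : Fin n → Fin (len τ)) →
    (∀ i j → X i < X j → g i <ᶠ g j) → (∀ i j → Y i < Y j → f τ (g i) <ᶠ f τ (g j)) →
    standardise ≼ τ
  embed {τ} g gX gY = g ∘ point , (λ p q → gX _ _ ∘ point-mono) , λ p q → gY _ _ ∘ point-value-mono , reflects p q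
    where
    reflects : ∀ p q → f τ (g (point p)) <ᶠ f τ (g (point q)) → f standardise p <ᶠ f standardise q
    reflects p q lt with ℕ.<-cmp (Y (point p)) (Y (point q))
    ... | tri< Yp<Yq _ _ = RY.rank-mono Yp<Yq
    ... | tri≈ _ eq _    = contradiction lt (ℕ.<-irrefl (cong (toℕ ∘ f τ ∘ g) (Y-inj eq)))
    ... | tri> _ _ Yq<Yp = contradiction (gY _ _ Yq<Yp) (ℕ.<-asym lt)

-- Templates and their inflation by decreasing sequences.

-- The formula writes a pair in base `suc n`; the last digit stays below the base, so the numbers
-- compare as the pairs do lexicographically.
lex-< : ∀ {n u v} (p q : Fin (suc n)) → u < v → u * suc n + toℕ p < v * suc n + toℕ q
lex-< {n} {u} {v} p q u<v = begin-strict
  u * suc n + toℕ p <⟨ ℕ.+-monoʳ-< (u * suc n) (Fin.toℕ<n p) ⟩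
  u * suc n + suc n ≡⟨ ℕ.+-comm (u * suc n) (suc n) ⟩
  suc u * suc n     ≤⟨ ℕ.*-monoˡ-≤ (suc n) u<v ⟩
  v * suc n         ≤⟨ ℕ.m≤m+n (v * suc n) (toℕ q) ⟩
  v * suc n + toℕ q ∎
  where open ℕ.≤-Reasoning

lex-<⁻¹ : ∀ {n u v} (p q : Fin (suc n)) → u * suc n + toℕ p < v * suc n + toℕ q → u < v ⊎ (u ≡ v × p <ᶠ q)
lex-<⁻¹ {n} {u} {v} p q lt with ℕ.<-cmp u v
... | tri< u<v _ _  = inj₁ u<v
... | tri≈ _ refl _ = inj₂ (refl , ℕ.+-cancelˡ-< (u * suc n) _ _ lt)
... | tri> _ _ v<u  = contradiction (lex-< q p v<u) (ℕ.<-asym lt)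

lex-≡⁻¹ : ∀ {n u v} (p q : Fin (suc n)) → u * suc n + toℕ p ≡ v * suc n + toℕ q → u ≡ v × p ≡ q
lex-≡⁻¹ {n} {u} {v} p q eq with ℕ.<-cmp u v
... | tri< u<v _ _  = contradiction (lex-< p q u<v) (ℕ.<-irrefl eq)
... | tri≈ _ refl _ = refl , Fin.toℕ-injective (ℕ.+-cancelˡ-≡ (u * suc n) _ _ eq)
... | tri> _ _ v<u  = contradiction (lex-< q p v<u) (ℕ.<-irrefl (sym eq))

opposite-injective : ∀ {n} → Injective _≡_ _≡_ (opposite {n})
opposite-injective {_} {p} {q} eq = trans (sym (Fin.opposite-involutive p)) (trans (cong opposite eq) (Fin.opposite-involutive q))

opposite-cancel-< : ∀ {n} (p q : Fin n) → opposite p <ᶠ opposite q → q <ᶠ p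
opposite-cancel-< {n} p q lt = s≤s⁻¹
  (ℕ.∸-cancelʳ-< {suc (toℕ p)} {suc (toℕ q)} {n} (subst₂ _<_ (Fin.opposite-prop p) (Fin.opposite-prop q) lt))

opposite-anti-< : ∀ {n} (p q : Fin n) → p <ᶠ q → opposite q <ᶠ opposite p
opposite-anti-< {n} p q lt =
  subst₂ _<_ (sym (Fin.opposite-prop q)) (sym (Fin.opposite-prop p)) (ℕ.∸-monoʳ-< (s≤s lt) (Fin.toℕ<n q))

-- The finite skeleton of an infinite family: the last `fat` points become decreasing sequences
-- whose length is chosen only on inflation, so that finite checks on cells serve all lengths.
record Template : Set where
  field
    thin fat : ℕ
    col row  : Fin (thin + fat) → ℕ
    col-inj  : Injective _≡_ _≡_ col
    row-inj  : Injective _≡_ _≡_ row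

  Cell : Set
  Cell = Fin (thin + fat)

  IsFat : Cell → Set
  IsFat k = ∃ λ c → k ≡ thin ↑ʳ c

module Inflation (T : Template) (n : ℕ) where
  open Template T

  size : ℕ
  size = thin + fat * suc n

  cell⊎ : Fin thin ⊎ Fin (fat * suc n) → Cell × Fin (suc n)
  cell⊎ (inj₁ t) = t ↑ˡ fat , zero
  cell⊎ (inj₂ z) = thin ↑ʳ proj₁ (remQuot {fat} (suc n) z) , proj₂ (remQuot {fat} (suc n) z)

  cell : Fin size → Cell
  cell i = proj₁ (cell⊎ (splitAt thin i))

  offset : Fin size → Fin (suc n)
  offset i = proj₂ (cell⊎ (splitAt thin i))

  place⊎ : Fin thin ⊎ Fin fat → Fin (suc n) → Fin size
  place⊎ (inj₁ t) j = t ↑ˡ (fat * suc n)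
  place⊎ (inj₂ c) j = thin ↑ʳ combine c j

  -- Thin cells ignore the offset. Hence a single offset can select one point from every cell at
  -- once.
  place : Cell → Fin (suc n) → Fin size
  place k = place⊎ (splitAt thin k)

  place-cell : ∀ i → place (cell i) (offset i) ≡ i
  place-cell i = trans (lemma (splitAt thin i)) (Fin.join-splitAt thin (fat * suc n) i)
    where
    lemma : ∀ s → place (proj₁ (cell⊎ s)) (proj₂ (cell⊎ s)) ≡ join thin (fat * suc n) s
    lemma (inj₁ t) rewrite Fin.splitAt-↑ˡ thin t fat = refl
    lemma (inj₂ z) rewrite Fin.splitAt-↑ʳ thin fat (proj₁ (remQuot {fat} (suc n) z)) =
      cong (thin ↑ʳ_) (Fin.combine-remQuot {fat} (suc n) z)

  cell-place : ∀ k j → cell (place k j) ≡ k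
  cell-place k j = trans (lemma (splitAt thin k)) (Fin.join-splitAt thin fat k)
    where
    lemma : ∀ s → cell (place⊎ s j) ≡ join thin fat s
    lemma (inj₁ t) rewrite Fin.splitAt-↑ˡ thin t (fat * suc n) = refl
    lemma (inj₂ c) rewrite Fin.splitAt-↑ʳ thin (fat * suc n) (combine c j) =
      cong ((thin ↑ʳ_) ∘ proj₁) (Fin.remQuot-combine {fat} c j)

  offset-place : ∀ {k} j → IsFat k → offset (place k j) ≡ j
  offset-place j (c , refl)
    rewrite Fin.splitAt-↑ʳ thin fat c | Fin.splitAt-↑ʳ thin (fat * suc n) (combine c j) =
      cong proj₂ (Fin.remQuot-combine {fat} c j)

  thin⊎fat : ∀ i → (∃ λ t → cell i ≡ t ↑ˡ fat × offset i ≡ zero) ⊎ IsFat (cell i)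
  thin⊎fat i with splitAt thin i
  ... | inj₁ t = inj₁ (t , refl , refl)
  ... | inj₂ z = inj₂ (_ , refl)

  -- An offset that exceeds another is not `zero`, the only offset in a thin cell.
  offset<⇒fat : ∀ i j → offset i <ᶠ offset j → IsFat (cell j)
  offset<⇒fat i j lt with thin⊎fat j
  ... | inj₂ fat = fat
  ... | inj₁ (_ , _ , eq) = ⊥-elim (ℕ.n≮0 (subst (offset i <ᶠ_) eq lt))

  -- Fat cells are filled by decreasing sequences.
  X Y : Fin size → ℕ
  X i = col (cell i) * suc n + toℕ (offset i)
  Y i = row (cell i) * suc n + toℕ (opposite (offset i))

  same-point : ∀ {i j} → cell i ≡ cell j → offset i ≡ offset j → i ≡ j
  same-point {i} {j} c o = trans (sym (place-cell i)) (trans (cong₂ place c o) (place-cell j))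

  col<⇒X< : ∀ i j → col (cell i) < col (cell j) → X i < X j
  col<⇒X< i j = lex-< (offset i) (offset j)

  row<⇒Y< : ∀ i j → row (cell i) < row (cell j) → Y i < Y j
  row<⇒Y< i j = lex-< (opposite (offset i)) (opposite (offset j))

  offset<⇒X< : ∀ i j → cell i ≡ cell j → offset i <ᶠ offset j → X i < X j
  offset<⇒X< i j eq lt = subst (λ k → X i < col k * suc n + toℕ (offset j)) eq (ℕ.+-monoʳ-< (col (cell i) * suc n) lt)

  offset<⇒Y> : ∀ i j → cell i ≡ cell j → offset i <ᶠ offset j → Y j < Y i
  offset<⇒Y> i j eq lt = subst (λ k → Y j < row k * suc n + toℕ (opposite (offset i))) (sym eq)
    (ℕ.+-monoʳ-< (row (cell j) * suc n) (opposite-anti-< (offset i) (offset j) lt))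

  X<⇒ : ∀ i j → X i < X j → col (cell i) < col (cell j) ⊎ (cell i ≡ cell j × offset i <ᶠ offset j)
  X<⇒ i j lt with lex-<⁻¹ (offset i) (offset j) lt
  ... | inj₁ c       = inj₁ c
  ... | inj₂ (c , o) = inj₂ (col-inj c , o)

  Y<⇒ : ∀ i j → Y i < Y j → row (cell i) < row (cell j) ⊎ (cell i ≡ cell j × offset j <ᶠ offset i)
  Y<⇒ i j lt with lex-<⁻¹ (opposite (offset i)) (opposite (offset j)) lt
  ... | inj₁ c       = inj₁ c
  ... | inj₂ (c , o) = inj₂ (row-inj c , opposite-cancel-< (offset i) (offset j) o)

  -- Points of one cell decrease, so an increasing pair comes from two cells, whose distinct columns
  -- and rows then decide the order.
  increasing⇒ : ∀ i j → X i < X j → Y i < Y j → col (cell i) < col (cell j) × row (cell i) < row (cell j)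
  increasing⇒ i j x y with X<⇒ i j x | Y<⇒ i j y
  ... | inj₁ c        | inj₁ r        = c , r
  ... | inj₁ c        | inj₂ (eq , _) = contradiction c (ℕ.<-irrefl (cong col eq))
  ... | inj₂ (eq , _) | inj₁ r        = contradiction r (ℕ.<-irrefl (cong row eq))
  ... | inj₂ (_ , o)  | inj₂ (_ , o′) = contradiction o (ℕ.<-asym o′)

  decreasing⇒ : ∀ i j → X i < X j → Y j < Y i →
    (col (cell i) < col (cell j) × row (cell j) < row (cell i)) ⊎ (cell i ≡ cell j × IsFat (cell i))
  decreasing⇒ i j x y with X<⇒ i j x | Y<⇒ j i y
  ... | inj₁ c        | inj₁ r        = inj₁ (c , r)
  ... | inj₁ c        | inj₂ (eq , _) = contradiction c (ℕ.<-irrefl (cong col (sym eq)))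
  ... | inj₂ (eq , o) | _             = inj₂ (eq , subst IsFat (sym eq) (offset<⇒fat i j o))

  -- Pigeonhole: a thin cell holds only one point.
  distinct⇒meets-fat : ∀ {m} → thin < m → (g : Fin m → Fin size) →
    (∀ {i j} → i <ᶠ j → ¬ g i ≡ g j) → ∃ λ j → IsFat (cell (g j))
  distinct⇒meets-fat {m} thin<m g distinct with Fin.any? (λ j → Fin.any? (λ c → cell (g j) Fin.≟ thin ↑ʳ c))
  ... | yes found = found
  ... | no none = contradiction same (distinct i<j)
    where
    thinCell : ∀ j → ∃ λ t → cell (g j) ≡ t ↑ˡ fat × offset (g j) ≡ zero
    thinCell j with thin⊎fat (g j)
    ... | inj₁ t     = t
    ... | inj₂ isFat = contradiction (j , isFat) none
    clash : ∃ λ i → ∃ λ j → i <ᶠ j × proj₁ (thinCell i) ≡ proj₁ (thinCell j)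
    clash = Fin.pigeonhole thin<m (proj₁ ∘ thinCell)
    i j : Fin m
    i = proj₁ clash
    j = proj₁ (proj₂ clash)
    i<j : i <ᶠ j
    i<j = proj₁ (proj₂ (proj₂ clash))
    same : g i ≡ g j
    same = same-point
      (trans (proj₁ (proj₂ (thinCell i))) (trans (cong (_↑ˡ fat) (proj₂ (proj₂ (proj₂ clash)))) (sym (proj₁ (proj₂ (thinCell j))))))
      (trans (proj₂ (proj₂ (thinCell i))) (sym (proj₂ (proj₂ (thinCell j)))))

  X-inj : Injective _≡_ _≡_ X
  X-inj {i} {j} eq with lex-≡⁻¹ (offset i) (offset j) eq
  ... | c , o = same-point (col-inj c) o

  Y-inj : Injective _≡_ _≡_ Y
  Y-inj {i} {j} eq with lex-≡⁻¹ (opposite (offset i)) (opposite (offset j)) eq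
  ... | c , o = same-point (row-inj c) (opposite-injective o)

  open PointSet X Y X-inj Y-inj public

inflate : Template → ℕ → Perm
inflate T n = Inflation.standardise T n

-- Excluding containment by a finite search over cells.

module _ (P S : Template) where

  private
    module P = Template P
    module S = Template S

  -- A necessary condition for points in cells `s` and `t` to be images of points from cells `k` and
  -- `l`: only a decreasing pair can collapse into one cell, and that cell must be fat.
  Compatible : P.Cell → P.Cell → S.Cell → S.Cell → Set
  Compatible k l s t = P.col k < P.col l →
      (P.row k < P.row l → S.col s < S.col t × S.row s < S.row t)
    × (P.row l < P.row k → (S.col s < S.col t × S.row t < S.row s) ⊎ (s ≡ t × S.IsFat s))

  compatible? : ∀ k l s t → Dec (Compatible k l s t)
  compatible? k l s t = P.col k ℕ.<? P.col l →-dec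
    ((P.row k ℕ.<? P.row l →-dec (S.col s ℕ.<? S.col t ×-dec S.row s ℕ.<? S.row t))
    ×-dec (P.row l ℕ.<? P.row k →-dec
      ((S.col s ℕ.<? S.col t ×-dec S.row t ℕ.<? S.row s) ⊎-dec (s Fin.≟ t ×-dec Fin.any? (λ c → s Fin.≟ S.thin ↑ʳ c)))))

  Domains : ℕ → Set
  Domains n = Vec (P.Cell × List S.Cell) n

  prune : ∀ {n} → P.Cell → S.Cell → Domains n → Domains n
  -- Both orders are tested, for `Compatible` constrains only pairs given from left to right.
  prune k s = Vec.map λ (l , ts) → l , filter (λ t → compatible? k l s t ×-dec compatible? l k t s) ts

  dead : ∀ {n} → Domains n → Bool
  dead []              = false
  dead ((_ , ss) ∷ ds) = null ss ∨ dead ds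

  -- Backtracking with forward checking for an assignment of cells of S to cells of P.
  refute refuteLive : ∀ {n} → Domains n → Bool
  refute ds = dead ds ∨ refuteLive ds
  refuteLive []              = false
  refuteLive ((k , ss) ∷ ds) = all (λ s → refute (prune k s ds)) ss

  module _ (A : P.Cell → S.Cell) (A-compatible : ∀ k l → Compatible k l (A k) (A l)) where

    Admits : ∀ {n} → Domains n → Set
    Admits []              = ⊤
    Admits ((k , ss) ∷ ds) = A k ∈ ss × Admits ds

    prune-admits : ∀ {n} k (ds : Domains n) → Admits ds → Admits (prune k (A k) ds)
    prune-admits k []              _       = tt
    prune-admits k ((l , ts) ∷ ds) (m , a) =
      ∈-filter⁺ _ m (A-compatible k l , A-compatible l k) , prune-admits k ds a

    alive : ∀ {n} (ds : Domains n) → Admits ds → ¬ T (dead ds)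
    alive ((_ , List.[]) ∷ ds)    (() , _)
    alive ((_ , _ List.∷ _) ∷ ds) (_ , a) = alive ds a

    -- On the branch that always picks the value of `A`, pruning keeps the values of `A` in the
    -- remaining lists. No list runs empty there, so the branch ends in `false`.
    refute-sound : ∀ {n} (ds : Domains n) → T (refute ds) → ¬ Admits ds
    refuteLive-sound : ∀ {n} (ds : Domains n) → T (refuteLive ds) → ¬ Admits ds
    refute-sound ds r a with dead ds in eq
    ... | true  = alive ds a (subst T (sym eq) tt)
    ... | false = refuteLive-sound ds r a
    refuteLive-sound ((k , ss) ∷ ds) r (m , a) =
      refute-sound (prune k (A k) ds) (All.lookup (all⁺ _ ss r) m) (prune-admits k ds a)

  module _ (n : ℕ) (thin<n : S.thin < suc n) (d : Fin P.fat) where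

    private
      module πₙ = Inflation P n
      module σₙ = Inflation S n

    -- The search may start with `d` in a fat cell of `S`, because the points inflating `d`
    -- outnumber the thin cells.
    startDomains : ∀ {m} → Vec P.Cell m → Domains (suc m)
    startDomains order =
      (P.thin ↑ʳ d , List.map (S.thin ↑ʳ_) (allFin S.fat)) ∷ Vec.map (λ k → k , allFin _) order

    -- From an embedding, keep one point of every cell of `P`, chosen so that the one from `d` lands
    -- in a fat cell. Recording only the cells that are hit gives an assignment of the kind the
    -- search has ruled out.
    inflate-⋠ : ∀ {m} (order : Vec P.Cell m) → T (refute (startDomains order)) → ¬ (inflate P n ≼ inflate S n)
    inflate-⋠ order refuted (e , e-pos , e-val) = refute-sound A A-compatible (startDomains order) refuted admits
      where
      h : Fin πₙ.size → Fin σₙ.size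
      h = σₙ.point ∘ e ∘ πₙ.position

      hX : ∀ i j → πₙ.X i < πₙ.X j → σₙ.X (h i) < σₙ.X (h j)
      hX i j lt = σₙ.point-mono {e (πₙ.position i)} {e (πₙ.position j)}
        (e-pos (πₙ.position i) (πₙ.position j) (πₙ.position-mono {i} {j} lt))

      hY : ∀ i j → πₙ.Y i < πₙ.Y j → σₙ.Y (h i) < σₙ.Y (h j)
      hY i j lt = σₙ.point-value-mono {e (πₙ.position i)} {e (πₙ.position j)}
        (proj₁ (e-val (πₙ.position i) (πₙ.position j)) (πₙ.value-mono {i} {j} lt))

      dCell : P.Cell
      dCell = P.thin ↑ʳ d

      dPoint : Fin (suc n) → Fin πₙ.size
      dPoint = πₙ.place dCell

      dPoint-X : ∀ {i j} → i <ᶠ j → πₙ.X (dPoint i) < πₙ.X (dPoint j)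
      dPoint-X {i} {j} i<j = πₙ.offset<⇒X< (dPoint i) (dPoint j)
        (trans (πₙ.cell-place dCell i) (sym (πₙ.cell-place dCell j)))
        (subst₂ _<ᶠ_ (sym (πₙ.offset-place i (d , refl))) (sym (πₙ.offset-place j (d , refl))) i<j)

      meets-fat : ∃ λ j → S.IsFat (σₙ.cell (h (dPoint j)))
      meets-fat = σₙ.distinct⇒meets-fat thin<n (h ∘ dPoint)
        (λ {i} {j} i<j eq → ℕ.<-irrefl (cong σₙ.X eq) (hX (dPoint i) (dPoint j) (dPoint-X i<j)))

      centre : Fin (suc n)
      centre = proj₁ meets-fat

      image : P.Cell → Fin σₙ.size
      image k = h (πₙ.place k centre)

      A : P.Cell → S.Cell
      A k = σₙ.cell (image k)

      image-X : ∀ k l → P.col k < P.col l → σₙ.X (image k) < σₙ.X (image l)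
      image-X k l lt = hX (πₙ.place k centre) (πₙ.place l centre)
        (πₙ.col<⇒X< (πₙ.place k centre) (πₙ.place l centre) (subst₂ (λ u v → P.col u < P.col v)
          (sym (πₙ.cell-place k centre)) (sym (πₙ.cell-place l centre)) lt))

      image-Y : ∀ k l → P.row k < P.row l → σₙ.Y (image k) < σₙ.Y (image l)
      image-Y k l lt = hY (πₙ.place k centre) (πₙ.place l centre)
        (πₙ.row<⇒Y< (πₙ.place k centre) (πₙ.place l centre) (subst₂ (λ u v → P.row u < P.row v)
          (sym (πₙ.cell-place k centre)) (sym (πₙ.cell-place l centre)) lt))

      A-compatible : ∀ k l → Compatible k l (A k) (A l)
      A-compatible k l k<l =
        (λ r → σₙ.increasing⇒ (image k) (image l) (image-X k l k<l) (image-Y k l r)) ,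
        (λ r → σₙ.decreasing⇒ (image k) (image l) (image-X k l k<l) (image-Y l k r))

      admits-all : ∀ {m} (ks : Vec P.Cell m) → Admits A A-compatible (Vec.map (λ k → k , allFin _) ks)
      admits-all []       = tt
      admits-all (k ∷ ks) = ∈-allFin (A k) , admits-all ks

      admits : Admits A A-compatible (startDomains order)
      admits = subst (_∈ List.map (S.thin ↑ʳ_) (allFin S.fat)) (sym (proj₂ (proj₂ meets-fat))) (∈-map⁺ (S.thin ↑ʳ_) (∈-allFin _))
             , admits-all order

-- Enlarging an embedding by a cutting entry.

module _ (P S : Template) where

  private
    module P = Template P
    module S = Template S

  -- What is known about the place of one further point relative to the cells of S.
  record Sides : Set₁ where
    field
      Left Right Below Above : S.Cell → Set
      left?  : ∀ k → Dec (Left k)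
      right? : ∀ k → Dec (Right k)
      below? : ∀ k → Dec (Below k)
      above? : ∀ k → Dec (Above k)

  Ordered : (S.Cell → ℕ) → (S.Cell → Set) → (S.Cell → Set) → Maybe S.Cell → Maybe S.Cell → Set
  Ordered c Lower Upper (just k) (just l) = c k < c l
  Ordered c Lower Upper (just k) nothing  = Lower k
  Ordered c Lower Upper nothing  (just l) = Upper l
  -- The two cells of `P` compared by `Fits` are distinct, and the further point can play only one
  -- of them.
  Ordered c Lower Upper nothing  nothing  = ⊥

  ordered? : ∀ c {Lower Upper} → (∀ k → Dec (Lower k)) → (∀ k → Dec (Upper k)) →
    ∀ a b → Dec (Ordered c Lower Upper a b)
  ordered? c lower? upper? (just k) (just l) = c k ℕ.<? c l
  ordered? c lower? upper? (just k) nothing  = lower? k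
  ordered? c lower? upper? nothing  (just l) = upper? l
  ordered? c lower? upper? nothing  nothing  = no id

  -- Only a fat cell of `S` offers a decreasing sequence to which a fat cell of `P` can be sent
  -- offset by offset.
  FatImage : Maybe S.Cell → Set
  FatImage (just k) = S.IsFat k
  FatImage nothing  = ⊥

  fatImage? : ∀ a → Dec (FatImage a)
  fatImage? (just k) = Fin.any? (λ c → k Fin.≟ S.thin ↑ʳ c)
  fatImage? nothing  = no id

  -- The cell of P sent to nothing is played by the further point.
  Fits : Sides → (P.Cell → Maybe S.Cell) → Set
  Fits sides Θ =
      (∀ k l → P.col k < P.col l → Ordered S.col Left Right (Θ k) (Θ l))
    × (∀ k l → P.row k < P.row l → Ordered S.row Below Above (Θ k) (Θ l))
    × (∀ c → FatImage (Θ (P.thin ↑ʳ c)))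
    where open Sides sides

  fits? : ∀ sides Θ → Dec (Fits sides Θ)
  fits? sides Θ =
          Fin.all? (λ k → Fin.all? λ l → P.col k ℕ.<? P.col l →-dec ordered? S.col left? right? (Θ k) (Θ l))
    ×-dec Fin.all? (λ k → Fin.all? λ l → P.row k ℕ.<? P.row l →-dec ordered? S.row below? above? (Θ k) (Θ l))
    ×-dec Fin.all? (λ c → fatImage? (Θ (P.thin ↑ʳ c)))
    where open Sides sides

  module Hosted (n : ℕ) (τ : Perm) (host : inflate S n ≼ τ) where

    private
      module πₙ = Inflation P n
      module σₙ = Inflation S n

    E : S.Cell → Fin (suc n) → Fin (len τ)
    E k j = proj₁ host (σₙ.position (σₙ.place k j))

    E-X : ∀ k l i j → σₙ.X (σₙ.place k i) < σₙ.X (σₙ.place l j) → E k i <ᶠ E l j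
    E-X k l i j lt = proj₁ (proj₂ host) (σₙ.position (σₙ.place k i)) (σₙ.position (σₙ.place l j))
      (σₙ.position-mono {σₙ.place k i} {σₙ.place l j} lt)

    E-Y : ∀ k l i j → σₙ.Y (σₙ.place k i) < σₙ.Y (σₙ.place l j) → f τ (E k i) <ᶠ f τ (E l j)
    E-Y k l i j lt = proj₁ (proj₂ (proj₂ host) (σₙ.position (σₙ.place k i)) (σₙ.position (σₙ.place l j)))
      (σₙ.value-mono {σₙ.place k i} {σₙ.place l j} lt)

    E-col : ∀ k l i j → S.col k < S.col l → E k i <ᶠ E l j
    E-col k l i j lt = E-X k l i j (σₙ.col<⇒X< (σₙ.place k i) (σₙ.place l j)
      (subst₂ (λ u v → S.col u < S.col v) (sym (σₙ.cell-place k i)) (sym (σₙ.cell-place l j)) lt))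

    E-row : ∀ k l i j → S.row k < S.row l → f τ (E k i) <ᶠ f τ (E l j)
    E-row k l i j lt = E-Y k l i j (σₙ.row<⇒Y< (σₙ.place k i) (σₙ.place l j)
      (subst₂ (λ u v → S.row u < S.row v) (sym (σₙ.cell-place k i)) (sym (σₙ.cell-place l j)) lt))

    fat-offset : ∀ {k i j} → S.IsFat k → i <ᶠ j → σₙ.offset (σₙ.place k i) <ᶠ σₙ.offset (σₙ.place k j)
    fat-offset {k} {i} {j} isFat = subst₂ _<ᶠ_ (sym (σₙ.offset-place i isFat)) (sym (σₙ.offset-place j isFat))

    same-cell : ∀ k i j → σₙ.cell (σₙ.place k i) ≡ σₙ.cell (σₙ.place k j)
    same-cell k i j = trans (σₙ.cell-place k i) (sym (σₙ.cell-place k j))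

    E-fat-col : ∀ k i j → S.IsFat k → i <ᶠ j → E k i <ᶠ E k j
    E-fat-col k i j isFat lt = E-X k k i j
      (σₙ.offset<⇒X< (σₙ.place k i) (σₙ.place k j) (same-cell k i j) (fat-offset isFat lt))

    E-fat-row : ∀ k i j → S.IsFat k → i <ᶠ j → f τ (E k j) <ᶠ f τ (E k i)
    E-fat-row k i j isFat lt = E-Y k k j i
      (σₙ.offset<⇒Y> (σₙ.place k i) (σₙ.place k j) (same-cell k i j) (fat-offset isFat lt))

    anchor : Fin S.thin → Fin (len τ)
    anchor t = E (t ↑ˡ S.fat) zero

    E-thin : ∀ t j → E (t ↑ˡ S.fat) j ≡ anchor t
    E-thin t j rewrite Fin.splitAt-↑ˡ S.thin t S.fat = refl

    -- c and w stand for columns and positions, or for rows and values.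
    module _ (c : S.Cell → ℕ) (c-inj : Injective _≡_ _≡_ c) (w : Fin (len τ) → ℕ)
             (w-mono : ∀ k l i j → c k < c l → w (E k i) < w (E l j)) where

      -- A tie forces `k` to be the thin cell itself, where all offsets name the same entry.
      E≤anchor : ∀ t k j → c k ≤ c (t ↑ˡ S.fat) → w (E k j) ≤ w (anchor t)
      E≤anchor t k j le with ℕ.m≤n⇒m<n∨m≡n le
      ... | inj₁ lt = ℕ.<⇒≤ (w-mono k (t ↑ˡ S.fat) j zero lt)
      ... | inj₂ eq with refl ← c-inj eq = ℕ.≤-reflexive (cong w (E-thin t j))

      anchor≤E : ∀ t k j → c (t ↑ˡ S.fat) ≤ c k → w (anchor t) ≤ w (E k j)
      anchor≤E t k j le with ℕ.m≤n⇒m<n∨m≡n le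
      ... | inj₁ lt = ℕ.<⇒≤ (w-mono (t ↑ˡ S.fat) k zero j lt)
      ... | inj₂ eq with refl ← c-inj eq = ℕ.≤-reflexive (cong w (sym (E-thin t j)))

    Located : Sides → Fin (len τ) → Set
    Located sides x =
        (∀ k j → Left k → E k j <ᶠ x)
      × (∀ k j → Right k → x <ᶠ E k j)
      × (∀ k j → Below k → f τ (E k j) <ᶠ f τ x)
      × (∀ k j → Above k → f τ x <ᶠ f τ (E k j))
      where open Sides sides

    -- Each point moves, with the same offset, to the cell of `S` that plays its own, or else to
    -- `x`. Points of different cells are ordered by `Fits`; two points of one cell lie in a fat
    -- cell, whose image decreases as well.
    extend : ∀ sides Θ x → Fits sides Θ → Located sides x → inflate P n ≼ τ
    extend sides Θ x (fitCols , fitRows , fitFat) (onLeft , onRight , onBottom , onTop) = πₙ.embed {τ} g g-X g-Y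
      where
      open Sides sides

      choose : Maybe S.Cell → Fin (suc n) → Fin (len τ)
      choose (just k) j = E k j
      choose nothing  j = x

      choose-col : ∀ a b i j → Ordered S.col Left Right a b → choose a i <ᶠ choose b j
      choose-col (just k) (just l) i j = E-col k l i j
      choose-col (just k) nothing  i j = onLeft k i
      choose-col nothing  (just l) i j = onRight l j

      choose-row : ∀ a b i j → Ordered S.row Below Above a b → f τ (choose a i) <ᶠ f τ (choose b j)
      choose-row (just k) (just l) i j = E-row k l i j
      choose-row (just k) nothing  i j = onBottom k i
      choose-row nothing  (just l) i j = onTop l j

      choose-fat-col : ∀ a i j → FatImage a → i <ᶠ j → choose a i <ᶠ choose a j
      choose-fat-col (just k) i j = E-fat-col k i j

      choose-fat-row : ∀ a i j → FatImage a → i <ᶠ j → f τ (choose a j) <ᶠ f τ (choose a i)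
      choose-fat-row (just k) i j = E-fat-row k i j

      fat⇒image : ∀ {k} → P.IsFat k → FatImage (Θ k)
      fat⇒image (c , refl) = fitFat c

      g : Fin πₙ.size → Fin (len τ)
      g i = choose (Θ (πₙ.cell i)) (πₙ.offset i)

      g-X : ∀ i j → πₙ.X i < πₙ.X j → g i <ᶠ g j
      g-X i j lt = [ (λ c → choose-col (Θ (πₙ.cell i)) (Θ (πₙ.cell j)) _ _ (fitCols _ _ c)) ,
        (λ (eq , o) → subst (λ k → choose (Θ k) (πₙ.offset i) <ᶠ g j) (sym eq)
          (choose-fat-col (Θ (πₙ.cell j)) _ _ (fat⇒image (πₙ.offset<⇒fat i j o)) o)) ]′ (πₙ.X<⇒ i j lt)

      g-Y : ∀ i j → πₙ.Y i < πₙ.Y j → f τ (g i) <ᶠ f τ (g j)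
      g-Y i j lt = [ (λ r → choose-row (Θ (πₙ.cell i)) (Θ (πₙ.cell j)) _ _ (fitRows _ _ r)) ,
        (λ (eq , o) → subst (λ k → f τ (g i) <ᶠ f τ (choose (Θ k) (πₙ.offset j))) eq
          (choose-fat-row (Θ (πₙ.cell i)) _ _ (fat⇒image (πₙ.offset<⇒fat j i o)) o)) ]′ (πₙ.Y<⇒ i j lt)

  module Pair (s t : Fin S.thin) where

    private
      c₁ c₂ : S.Cell
      c₁ = s ↑ˡ S.fat
      c₂ = t ↑ˡ S.fat

    -- In the direction in which `x` leaves the hull of the pair, nothing is known to lie beyond it,
    -- hence the `⊥`.
    aboveSides belowSides leftSides rightSides : Sides
    aboveSides = record
      { Left  = λ k → S.col k ≤ S.col c₁ ; left?  = λ k → S.col k ℕ.≤? S.col c₁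
      ; Right = λ k → S.col c₂ ≤ S.col k ; right? = λ k → S.col c₂ ℕ.≤? S.col k
      ; Below = λ k → S.row k ≤ S.row c₂ ; below? = λ k → S.row k ℕ.≤? S.row c₂
      ; Above = λ k → ⊥                  ; above? = λ k → no id }
    belowSides = record
      { Left  = λ k → S.col k ≤ S.col c₁ ; left?  = λ k → S.col k ℕ.≤? S.col c₁
      ; Right = λ k → S.col c₂ ≤ S.col k ; right? = λ k → S.col c₂ ℕ.≤? S.col k
      ; Below = λ k → ⊥                  ; below? = λ k → no id
      ; Above = λ k → S.row c₁ ≤ S.row k ; above? = λ k → S.row c₁ ℕ.≤? S.row k }
    leftSides = record
      { Left  = λ k → ⊥                  ; left?  = λ k → no id
      ; Right = λ k → S.col c₁ ≤ S.col k ; right? = λ k → S.col c₁ ℕ.≤? S.col k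
      ; Below = λ k → S.row k ≤ S.row c₁ ; below? = λ k → S.row k ℕ.≤? S.row c₁
      ; Above = λ k → S.row c₂ ≤ S.row k ; above? = λ k → S.row c₂ ℕ.≤? S.row k }
    rightSides = record
      { Left  = λ k → S.col k ≤ S.col c₂ ; left?  = λ k → S.col k ℕ.≤? S.col c₂
      ; Right = λ k → ⊥                  ; right? = λ k → no id
      ; Below = λ k → S.row k ≤ S.row c₁ ; below? = λ k → S.row k ℕ.≤? S.row c₁
      ; Above = λ k → S.row c₂ ≤ S.row k ; above? = λ k → S.row c₂ ℕ.≤? S.row k }

    -- Simplicity makes some `x` cut the pair, and each of the four kinds of cut has its own copy of
    -- `P` to complete. The cell `k` provides the entry to the right that `simple⇒cut` asks for.
    simple-host : ∀ {Θ↑ Θ↓ Θ← Θ→} →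
      Fits aboveSides Θ↑ → Fits belowSides Θ↓ → Fits leftSides Θ← → Fits rightSides Θ→ →
      S.col c₁ < S.col c₂ → S.row c₁ < S.row c₂ → (∃ λ k → S.col c₂ < S.col k) →
      ∀ n τ → Simple τ → inflate S n ≼ τ → inflate P n ≼ τ
    simple-host {Θ↑} {Θ↓} {Θ←} {Θ→} fit↑ fit↓ fit← fit→ col< row< (k , c₂<k) n τ simple host =
      extension (simple⇒cut τ {anchor s} {anchor t} (E-col c₁ c₂ zero zero col<) (E-row c₁ c₂ zero zero row<)
        simple (E k zero , E-col c₂ k zero zero c₂<k))
      where
      open Hosted n τ host
      col≤ = E≤anchor S.col S.col-inj toℕ E-col
      ≤col = anchor≤E S.col S.col-inj toℕ E-col
      row≤ = E≤anchor S.row S.row-inj (toℕ ∘ f τ) E-row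
      ≤row = anchor≤E S.row S.row-inj (toℕ ∘ f τ) E-row
      extension : Cut τ (anchor s) (anchor t) → inflate P n ≼ τ
      extension (above x p<x x<q q<x) = extend aboveSides Θ↑ x fit↑
        ( (λ k j le → ℕ.≤-<-trans (col≤ s k j le) p<x) , (λ k j le → ℕ.<-≤-trans x<q (≤col t k j le))
        , (λ k j le → ℕ.≤-<-trans (row≤ t k j le) q<x) , λ k j () )
      extension (below x p<x x<q x<p) = extend belowSides Θ↓ x fit↓
        ( (λ k j le → ℕ.≤-<-trans (col≤ s k j le) p<x) , (λ k j le → ℕ.<-≤-trans x<q (≤col t k j le))
        , (λ k j ()) , λ k j le → ℕ.<-≤-trans x<p (≤row s k j le) )
      extension (leftOf x p<x x<q x<p) = extend leftSides Θ← x fit←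
        ( (λ k j ()) , (λ k j le → ℕ.<-≤-trans x<p (≤col s k j le))
        , (λ k j le → ℕ.≤-<-trans (row≤ s k j le) p<x) , λ k j le → ℕ.<-≤-trans x<q (≤row t k j le) )
      extension (rightOf x p<x x<q q<x) = extend rightSides Θ→ x fit→
        ( (λ k j le → ℕ.≤-<-trans (col≤ t k j le) q<x) , (λ k j ())
        , (λ k j le → ℕ.≤-<-trans (row≤ s k j le) p<x) , λ k j le → ℕ.<-≤-trans x<q (≤row t k j le) )

-- The concrete templates and the conclusion.

injective? : ∀ {m} (c : Fin m → ℕ) → Dec (∀ k l → c k ≡ c l → k ≡ l)
injective? c = Fin.all? λ k → Fin.all? λ l → c k ℕ.≟ c l →-dec k Fin.≟ l

template : (thin fat : ℕ) (points : Vec (ℕ × ℕ) (thin + fat)) →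
  {True (injective? (proj₁ ∘ lookup points))} → {True (injective? (proj₂ ∘ lookup points))} → Template
template thin fat points {cols} {rows} = record
  { thin    = thin
  ; fat     = fat
  ; col     = proj₁ ∘ lookup points
  ; row     = proj₂ ∘ lookup points
  ; col-inj = toWitness cols _ _
  ; row-inj = toWitness rows _ _
  }

-- 25314[213, 132, d, 213, 132], in the order 2, 5, 1, 4, 3 of the inflated entries.
πT : Template
πT = template 12 1
  ( (0 , 4) ∷ (1 , 3) ∷ (2 , 5)
  ∷ (3 , 11) ∷ (4 , 13) ∷ (5 , 12)
  ∷ (8 , 1) ∷ (9 , 0) ∷ (10 , 2)
  ∷ (11 , 8) ∷ (12 , 10) ∷ (13 , 9)
  ∷ (6 , 6) ∷ [] )

-- The interleaving was found by computer search. First the pair I = 12; each further line is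
-- what is left of 25314[213, 132, d, 213, 132] when its block at 5, at 4, at 1, at 2 respectively
-- is removed, I standing in for that block; the last line has the four fat entries d.
σT : Template
σT = template 38 4
  ( (20 , 20) ∷ (21 , 21)
  ∷ (13 , 7) ∷ (14 , 6) ∷ (15 , 8) ∷ (36 , 4) ∷ (37 , 3) ∷ (38 , 5) ∷ (39 , 13) ∷ (40 , 15) ∷ (41 , 14)
  ∷ (0 , 11) ∷ (1 , 10) ∷ (2 , 12) ∷ (3 , 22) ∷ (4 , 24) ∷ (5 , 23) ∷ (16 , 1) ∷ (17 , 0) ∷ (18 , 2)
  ∷ (7 , 27) ∷ (8 , 26) ∷ (9 , 28) ∷ (10 , 33) ∷ (11 , 35) ∷ (12 , 34) ∷ (26 , 30) ∷ (27 , 32) ∷ (28 , 31)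
  ∷ (23 , 39) ∷ (24 , 41) ∷ (25 , 40) ∷ (30 , 18) ∷ (31 , 17) ∷ (32 , 19) ∷ (33 , 36) ∷ (34 , 38) ∷ (35 , 37)
  ∷ (22 , 9) ∷ (6 , 16) ∷ (19 , 29) ∷ (29 , 25) ∷ [] )

-- The thin cells 0 and 1 of `σT` are the two entries of I.
open Pair πT σT zero (suc zero)

-- I supplies the 1 and the 2 of the block 132 at 5, and the cutting entry its 3; the rest is the
-- copy lacking this block.
Θ↑ : Template.Cell πT → Maybe (Template.Cell σT)
Θ↑ = lookup
  ( just (# 2) ∷ just (# 3) ∷ just (# 4) ∷ just (# 0) ∷ nothing ∷ just (# 1)
  ∷ just (# 5) ∷ just (# 6) ∷ just (# 7) ∷ just (# 8) ∷ just (# 9) ∷ just (# 10)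
  ∷ just (# 38) ∷ [] )

-- In the block 213 at 1, the cutting entry is the 1, and I the 2 and the 3.
Θ↓ : Template.Cell πT → Maybe (Template.Cell σT)
Θ↓ = lookup
  ( just (# 20) ∷ just (# 21) ∷ just (# 22) ∷ just (# 23) ∷ just (# 24) ∷ just (# 25)
  ∷ just (# 0) ∷ nothing ∷ just (# 1) ∷ just (# 26) ∷ just (# 27) ∷ just (# 28)
  ∷ just (# 40) ∷ [] )

-- In the block 213 at 2, the cutting entry is the 2, and I the 1 and the 3.
Θ← : Template.Cell πT → Maybe (Template.Cell σT)
Θ← = lookup
  ( nothing ∷ just (# 0) ∷ just (# 1) ∷ just (# 29) ∷ just (# 30) ∷ just (# 31)
  ∷ just (# 32) ∷ just (# 33) ∷ just (# 34) ∷ just (# 35) ∷ just (# 36) ∷ just (# 37)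
  ∷ just (# 41) ∷ [] )

-- In the block 132 at 4, the cutting entry is the 2, and I the 1 and the 3.
Θ→ : Template.Cell πT → Maybe (Template.Cell σT)
Θ→ = lookup
  ( just (# 11) ∷ just (# 12) ∷ just (# 13) ∷ just (# 14) ∷ just (# 15) ∷ just (# 16)
  ∷ just (# 17) ∷ just (# 18) ∷ just (# 19) ∷ just (# 0) ∷ just (# 1) ∷ nothing
  ∷ just (# 39) ∷ [] )

simple⇒πT : ∀ n τ → Simple τ → inflate σT n ≼ τ → inflate πT n ≼ τ
simple⇒πT = simple-host {Θ↑} {Θ↓} {Θ←} {Θ→}
  (toWitness {a? = fits? πT σT aboveSides Θ↑} tt)
  (toWitness {a? = fits? πT σT belowSides Θ↓} tt)
  (toWitness {a? = fits? πT σT leftSides Θ←} tt)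
  (toWitness {a? = fits? πT σT rightSides Θ→} tt)
  -- Cell 8 lies in column 39, to the right of column 21, where I ends.
  (toWitness {a? = _ ℕ.<? _} tt) (toWitness {a? = _ ℕ.<? _} tt) (# 8 , toWitness {a? = _ ℕ.<? _} tt)

σT-avoids-πT : ∀ n → 38 ≤ n → ¬ (inflate πT n ≼ inflate σT n)
-- `σT` has 38 thin cells, fewer than the `suc n` points of the decreasing sequence in `πT`.
σT-avoids-πT n 38≤n = inflate-⋠ πT σT n (s≤s 38≤n) zero
  -- After the centre, the search goes through the blocks at 5, 4, 1 and 2; accepting `tt` means
  -- that it runs to completion during type checking.
  (# 3 ∷ # 4 ∷ # 5 ∷ # 9 ∷ # 10 ∷ # 11 ∷ # 6 ∷ # 7 ∷ # 8 ∷ # 0 ∷ # 1 ∷ # 2 ∷ []) tt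

theorem4p3 : (N : ℕ) → Σ Perm λ π → (N ≤ len π) × Deflatable (Av π)
theorem4p3 N = inflate πT n , large ,
  deflatable-Av (inflate πT n) (inflate σT n) (σT-avoids-πT n (ℕ.m≤m+n 38 N)) (simple⇒πT n)
  where
  n : ℕ
  -- The summand 38 meets the bound for avoidance, and `N` makes the lengths unbounded, which yields
  -- infinitely many permutations.
  n = 38 + N
  large : N ≤ 12 + 1 * suc n
  large = ℕ.≤-trans (ℕ.m≤n+m N 39) (ℕ.≤-trans (ℕ.≤-reflexive (sym (ℕ.*-identityˡ (suc n)))) (ℕ.m≤n+m (1 * suc n) 12))
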